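{- Let $G_1$ be an $(N_1,D_1,\lambda_1)$-graph on vertex set $[N_1]$ and let $G_2$ be a $(D_1,D_2,\lambda_2)$-graph on vertex set $[D_1]$. Then the zig-zag product of $G_1$ and $G_2$ is an $(N_1\cdot D_1,\; D_2^2,\; \lambda_1+\lambda_2+\lambda_2^2)$-graph.
   Context: For a positive integer $n$, $[n]=\{1,\dots,n\}$. Graphs are finite, undirected and regular, and may have self-loops and parallel edges. A $D$-regular graph $G$ on $[N]$ is specified by its rotation map $\mathrm{Rot}_G:[N]\times[D]\to[N]\times[D]$: $\mathrm{Rot}_G(v,i)=(w,j)$ means that the $i$-th edge incident to $v$ leads to $w$ and that this edge is the $j$-th edge incident to $w$. Thus $\mathrm{Rot}_G$ is a permutation with $\mathrm{Rot}_G\circ\mathrm{Rot}_G=\mathrm{id}$ (and any such involution specifies a $D$-regular graph). Vertex sets and sets of edge labels may be any finite sets of the right cardinality. The normalized adjacency matrix of $G$ is the symmetric $N\times N$ matrix with $M_{u,v}=\frac1D|\{(i,j)\in[D]^2:\mathrm{Rot}_G(u,i)=(v,j)\}|$. The second largest eigenvalue in absolute value is $\lambda(G)=\max_{\alpha\perp 1_N,\,\alpha\ne0}\|M\alpha\|/\|\alpha\|$, where $1_N$ is the all-ones vector and the norm is Euclidean (with $\lambda(G)=0$ if $N=1$). An $(N,D,\lambda)$-graph is a $D$-regular graph on $N$ vertices with $\lambda(G)\le\lambda$. Zig-zag product: for a $D_1$-regular graph $G_1$ on $[N_1]$ and a $D_2$-regular graph $G_2$ on $[D_1]$, it is the $D_2^2$-regular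 graph on $[N_1]\times[D_1]$, with edge labels in $[D_2]\times[D_2]$, whose rotation map sends $((v,k),(i,j))$ to $((w,\ell),(j',i'))$, where $(k',i')=\mathrm{Rot}_{G_2}(k,i)$, then $(w,\ell')=\mathrm{Rot}_{G_1}(v,k')$, then $(\ell,j')=\mathrm{Rot}_{G_2}(\ell',j)$. -}

module Defs where

open import Algebra.Bundles using (CommutativeRing)
import Algebra.Definitions.RawMonoid as RawMonoidDefinitions
open import Data.Bool.Base using (if_then_else_)
open import Data.Fin.Base using (Fin)
import Data.Fin.Properties as Fin
open import Data.List.Base using (length; filter; allFin; cartesianProduct)
open import Data.Nat.Base as ℕ using (ℕ)
import Data.Nat.Properties as ℕ
open import Data.Product.Base using (_×_; _,_; ∃; map; proj₁; proj₂)
open import Data.Product.Properties using (≡-dec)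
open import Data.Vec.Functional using (Vector)
open import Function.Base using (_∘_)
open import Function.Bundles using (_↔_; Inverse)
open import Level using (Lift; _⊔_) renaming (suc to lsuc)
open import Relation.Binary.Core using (Rel)
open import Relation.Binary.PropositionalEquality
  using (_≡_; refl; cong; cong₂; module ≡-Reasoning)
open import Relation.Binary.Structures using (IsDecTotalOrder)
open import Relation.Nullary.Decidable.Core using (⌊_⌋)
open import Relation.Nullary.Negation.Core using (¬_)
open import Relation.Unary using (Pred; Satisfiable)

-- The real numbers, given axiomatically: classically, a Dedekind-complete
-- ordered field is unique up to isomorphism.  The reading is the classical one
-- (decidable order, suprema of arbitrary bounded inhabited predicates).
-- _⁻¹, √ and sup are total operations; nothing is assumed about their values
-- outside the usual domains.  Square roots follow from completeness and are
-- included only so that the Euclidean norm can be written down directly.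
record CompleteOrderedField c ℓ₁ ℓ₂ : Set (lsuc (c ⊔ ℓ₁ ⊔ ℓ₂)) where
  infix  4 _≤_
  infix  8 _⁻¹
  field
    commutativeRing : CommutativeRing c ℓ₁

  open CommutativeRing commutativeRing public

  field
    _≤_             : Rel Carrier ℓ₂
    isDecTotalOrder : IsDecTotalOrder _≈_ _≤_
    +-monoˡ-≤       : ∀ z {x y} → x ≤ y → x + z ≤ y + z
    *-nonNeg        : ∀ {x y} → 0# ≤ x → 0# ≤ y → 0# ≤ x * y
    1≉0             : ¬ (1# ≈ 0#)
    _⁻¹             : Carrier → Carrier
    *-inverseʳ      : ∀ {x} → ¬ (x ≈ 0#) → x * x ⁻¹ ≈ 1#
    √               : Carrier → Carrier
    √-nonNeg        : ∀ {x} → 0# ≤ x → 0# ≤ √ x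
    √-square        : ∀ {x} → 0# ≤ x → √ x * √ x ≈ x

  UpperBound : ∀ {p} → Pred Carrier p → Pred Carrier (c ⊔ ℓ₂ ⊔ p)
  UpperBound P b = ∀ {x} → P x → x ≤ b

  field
    sup       : Pred Carrier (c ⊔ ℓ₁ ⊔ ℓ₂) → Carrier
    sup-upper : ∀ {P} → Satisfiable P → Satisfiable (UpperBound P) → UpperBound P (sup P)
    sup-least : ∀ {P b} → Satisfiable P → UpperBound P b → sup P ≤ b

-- A regular graph with vertex set V and edge-label set E, as a rotation map.
record RegularGraph (V E : Set) : Set where
  field
    rot            : V × E → V × E
    rot-involutive : ∀ x → rot (rot x) ≡ x

open RegularGraph public

Graph : ℕ → ℕ → Set
Graph N D = RegularGraph (Fin N) (Fin D)

relabel : ∀ {V V′ E E′ : Set} → V′ ↔ V → E′ ↔ E → RegularGraph V E → RegularGraph V′ E′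
relabel {V} {V′} {E} {E′} f g G = record { rot = rot′ ; rot-involutive = involutive }
  where
  module f = Inverse f
  module g = Inverse g

  enc : V × E → V′ × E′
  enc = map f.from g.from

  dec : V′ × E′ → V × E
  dec = map f.to g.to

  rot′ : V′ × E′ → V′ × E′
  rot′ = enc ∘ rot G ∘ dec

  dec-enc : ∀ x → dec (enc x) ≡ x
  dec-enc (v , e) = cong₂ _,_ (f.strictlyInverseˡ v) (g.strictlyInverseˡ e)

  enc-dec : ∀ x → enc (dec x) ≡ x
  enc-dec (v , e) = cong₂ _,_ (f.strictlyInverseʳ v) (g.strictlyInverseʳ e)

  involutive : ∀ x → rot′ (rot′ x) ≡ x
  involutive x = begin
    enc (rot G (dec (enc (rot G (dec x))))) ≡⟨ cong (enc ∘ rot G) (dec-enc _) ⟩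
    enc (rot G (rot G (dec x)))             ≡⟨ cong enc (rot-involutive G _) ⟩
    enc (dec x)                             ≡⟨ enc-dec x ⟩
    x                                       ∎
    where open ≡-Reasoning

module _ {V K E : Set} (G₁ : RegularGraph V K) (G₂ : RegularGraph K E) where

  zigzagRot : (V × K) × (E × E) → (V × K) × (E × E)
  zigzagRot ((v , k) , (i , j)) =
    let (k′ , i′) = rot G₂ (k , i)
        (w  , ℓ′) = rot G₁ (v , k′)
        (ℓ  , j′) = rot G₂ (ℓ′ , j)
    in  (w , ℓ) , (j′ , i′)

  zigzagRot-involutive : ∀ x → zigzagRot (zigzagRot x) ≡ x
  zigzagRot-involutive ((v , k) , (i , j))
    rewrite rot-involutive G₂ (proj₂ (rot G₁ (v , proj₁ (rot G₂ (k , i)))) , j)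
          | rot-involutive G₁ (v , proj₁ (rot G₂ (k , i)))
          | rot-involutive G₂ (k , i)
          = refl

  zigzagProduct : RegularGraph (V × K) (E × E)
  zigzagProduct = record { rot = zigzagRot ; rot-involutive = zigzagRot-involutive }

-- Fin N₁ × Fin D₁ and Fin D₂ × Fin D₂ are enumerated by Fin (N₁ * D₁) and
-- Fin (D₂ * D₂), so that the product is again a Graph.
infixl 7 _ⓩ_
_ⓩ_ : ∀ {N₁ D₁ D₂} → Graph N₁ D₁ → Graph D₁ D₂ → Graph (N₁ ℕ.* D₁) (D₂ ℕ.* D₂)
G₁ ⓩ G₂ = relabel Fin.*↔× Fin.*↔× (zigzagProduct G₁ G₂)

edgeCount : ∀ {N D} → Graph N D → Fin N → Fin N → ℕ
edgeCount {D = D} G u v =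
  length (filter (λ (i , j) → ≡-dec Fin._≟_ Fin._≟_ (rot G (u , i)) (v , j))
                 (cartesianProduct (allFin D) (allFin D)))

module Spectral {c ℓ₁ ℓ₂} (ℝ : CompleteOrderedField c ℓ₁ ℓ₂) where

  open CompleteOrderedField ℝ
  open RawMonoidDefinitions +-rawMonoid using (sum) renaming (_×_ to _·_)

  infixl 7 _/_
  _/_ : Carrier → Carrier → Carrier
  x / y = x * y ⁻¹

  fromℕ : ℕ → Carrier
  fromℕ n = n · 1#

  ⟨_,_⟩ : ∀ {n} → Vector Carrier n → Vector Carrier n → Carrier
  ⟨ α , β ⟩ = sum (λ i → α i * β i)

  ∥_∥ : ∀ {n} → Vector Carrier n → Carrier
  ∥ α ∥ = √ ⟨ α , α ⟩

  𝟙 : ∀ {n} → Vector Carrier n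
  𝟙 _ = 1#

  adjacency : ∀ {N D} → Graph N D → Fin N → Fin N → Carrier
  adjacency {D = D} G u v = fromℕ (edgeCount G u v) / fromℕ D

  _⊛_ : ∀ {m n} → (Fin m → Fin n → Carrier) → Vector Carrier n → Vector Carrier m
  (M ⊛ α) u = sum (λ v → M u v * α v)

  StretchRatio : ∀ {N D} → Graph N D → Pred Carrier (c ⊔ ℓ₁)
  StretchRatio {N} G r = ∃ λ (α : Vector Carrier N) →
    ⟨ α , 𝟙 ⟩ ≈ 0# × ¬ (∀ i → α i ≈ 0#) × r ≈ ∥ adjacency G ⊛ α ∥ / ∥ α ∥

  -- For N ≥ 2 and D ≥ 1 the ratios form a nonempty set, bounded by 1, whose
  -- supremum is attained (the unit sphere of 𝟙^⊥ is compact): it is a maximum.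
  secondEigenvalue : ∀ {N D} → Graph N D → Carrier
  secondEigenvalue {N} G =
    if ⌊ N ℕ.≟ 1 ⌋ then 0# else sup (λ r → Lift ℓ₂ (StretchRatio G r))

  IsNDλGraph : ∀ N D → Carrier → Graph N D → Set ℓ₂
  IsNDλGraph N D lam G = secondEigenvalue G ≤ lam

{-# OPTIONS --safe #-}
module Submission where

-- Write M for the normalized adjacency operator of a graph, B for that of G₂
-- acting on every fibre {v} × [D₁], and P for composition with Rot_{G₁}.  Then the
-- zig-zag product has M = BPB, and B is self-adjoint, so ⟨Mf, h⟩ = ⟨PBf, Bh⟩.
-- Split f = f₀ + f₁ and h = h₀ + h₁ into the part that is constant on fibres and
-- the part that sums to zero on fibres.  B fixes f₀ and h₀ and shrinks f₁ and h₁
-- by λ₂, and P shrinks f₀ by λ₁ when tested against h₀, so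
--   ⟨Mf, h⟩ ≤ λ₁ ∥f₀∥ ∥h₀∥ + λ₂ (∥f₀∥ ∥h₁∥ + ∥f₁∥ ∥h₀∥) + λ₂² ∥f₁∥ ∥h₁∥
--           ≤ (λ₁ + λ₂ + λ₂²) ∥f∥ ∥h∥,
-- the middle term by Cauchy–Schwarz in the plane.  Taking h = Mf bounds ∥Mf∥
-- without any appeal to the spectral theorem.

open import Defs
import Algebra.Properties.Ring as RingProperties
import Algebra.Properties.Semiring.Mult as SemiringMult
import Algebra.Properties.Semiring.Sum as SemiringSum
import Algebra.Solver.Ring.NaturalCoefficients.Default as SemiringSolver
open import Data.Bool.Base using (true; false; if_then_else_)
open import Data.Fin.Base using (Fin; zero; suc; _↑ˡ_; _↑ʳ_; combine; remQuot)
import Data.Fin.Permutation as Permutation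
import Data.Fin.Properties as Fin
open import Data.List.Base using (List; map; _++_; length; filter; tabulate; allFin; cartesianProduct)
import Data.List.Properties as List
open import Data.Nat.Base as ℕ using (ℕ; zero; suc; NonZero)
import Data.Nat.Properties as ℕ
open import Data.Product.Base using (_×_; _,_; ∃; proj₁; proj₂; uncurry)
open import Data.Product.Properties using (≡-dec)
open import Data.Sum.Base using (inj₁; inj₂)
open import Data.Vec.Functional using (Vector)
open import Function.Base using (_∘_; id; _$_)
open import Level using (Level; lift)
open import Relation.Binary.Bundles using (Poset)
import Relation.Binary.PropositionalEquality as ≡
open ≡ using (_≡_)
import Relation.Binary.Reasoning.PartialOrder as PartialOrderReasoning
open import Relation.Binary.Structures using (IsDecTotalOrder)
open import Relation.Nullary.Decidable using (Dec; yes; no; does)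
open import Relation.Nullary.Negation using (¬_)
open import Relation.Unary using (Pred; Decidable)

module _ {c ℓ₁ ℓ₂ : Level} (ℝ : CompleteOrderedField c ℓ₁ ℓ₂) where

  open CompleteOrderedField ℝ hiding (zero)
  open Spectral ℝ
  open SemiringSum semiring using
    (sum; sum-cong-≋; ∑-distrib-+; ∑-comm; *-distribˡ-sum; *-distribʳ-sum; sum-permute)
  open SemiringMult semiring using (×1-homo-*; ×-homo-+)
  open RingProperties ring using (-‿distribʳ-*)
  open SemiringSolver commutativeSemiring using (solve; _:=_; _:+_; _:*_; con)
  open IsDecTotalOrder isDecTotalOrder using (total; antisym; _≟_; isPartialOrder)
    renaming (refl to ≤-refl; trans to ≤-trans; reflexive to ≤-reflexive)

  poset : Poset c ℓ₁ ℓ₂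
  poset = record { isPartialOrder = isPartialOrder }

  open PartialOrderReasoning poset

  private variable
    m n N D : ℕ
    w x y z : Carrier

  -- Ordered field arithmetic

  +-monoʳ-≤ : ∀ z → x ≤ y → z + x ≤ z + y
  +-monoʳ-≤ {x} {y} z x≤y = begin
    z + x ≈⟨ +-comm z x ⟩
    x + z ≤⟨ +-monoˡ-≤ z x≤y ⟩
    y + z ≈⟨ +-comm y z ⟩
    z + y ∎

  +-mono-≤ : w ≤ x → y ≤ z → w + y ≤ x + z
  +-mono-≤ {x = x} {y} w≤x y≤z = ≤-trans (+-monoˡ-≤ y w≤x) (+-monoʳ-≤ x y≤z)

  +-nonNeg : 0# ≤ x → 0# ≤ y → 0# ≤ x + y
  +-nonNeg 0≤x 0≤y = ≤-trans (≤-reflexive (sym (+-identityˡ 0#))) (+-mono-≤ 0≤x 0≤y)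

  x≤x+y : 0# ≤ y → x ≤ x + y
  x≤x+y {y} {x} 0≤y = ≤-trans (≤-reflexive (sym (+-identityʳ x))) (+-monoʳ-≤ x 0≤y)

  +-cancelˡ-≤ : ∀ z → z + x ≤ z + y → x ≤ y
  +-cancelˡ-≤ {x} {y} z z+x≤z+y = begin
    x              ≈⟨ undo x ⟨
    - z + (z + x)  ≤⟨ +-monoʳ-≤ (- z) z+x≤z+y ⟩
    - z + (z + y)  ≈⟨ undo y ⟩
    y              ∎
    where
    undo : ∀ t → - z + (z + t) ≈ t
    undo t = trans (sym (+-assoc _ _ _)) (trans (+-congʳ (-‿inverseˡ z)) (+-identityˡ t))

  -- Trades an inequality for a nonnegative increment `t`, so that the identities below contain no
  -- subtraction and the commutative semiring solver proves them.
  ≤⇒∃+ : x ≤ y → ∃ λ t → 0# ≤ t × y ≈ x + t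
  ≤⇒∃+ {x} {y} x≤y = y + - x , 0≤t , eq
    where
    0≤t : 0# ≤ y + - x
    0≤t = ≤-trans (≤-reflexive (sym (-‿inverseʳ x))) (+-monoˡ-≤ (- x) x≤y)
    eq : y ≈ x + (y + - x)
    eq = begin-equality
      y              ≈⟨ +-identityʳ y ⟨
      y + 0#         ≈⟨ +-congˡ (-‿inverseʳ x) ⟨
      y + (x + - x)  ≈⟨ solve 3 (λ x y z → y :+ (x :+ z) := x :+ (y :+ z)) refl x y (- x) ⟩
      x + (y + - x)  ∎

  *-monoʳ-≤ : 0# ≤ z → x ≤ y → z * x ≤ z * y
  *-monoʳ-≤ {z} {x} {y} 0≤z x≤y with t , 0≤t , y≈x+t ← ≤⇒∃+ x≤y = begin
    z * x          ≤⟨ x≤x+y (*-nonNeg 0≤z 0≤t) ⟩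
    z * x + z * t  ≈⟨ distribˡ z x t ⟨
    z * (x + t)    ≈⟨ *-congˡ y≈x+t ⟨
    z * y          ∎

  *-monoˡ-≤ : 0# ≤ z → x ≤ y → x * z ≤ y * z
  *-monoˡ-≤ {z} {x} {y} 0≤z x≤y = begin
    x * z ≈⟨ *-comm x z ⟩
    z * x ≤⟨ *-monoʳ-≤ 0≤z x≤y ⟩
    z * y ≈⟨ *-comm z y ⟩
    y * z ∎

  *-mono-≤ : 0# ≤ w → 0# ≤ z → w ≤ x → y ≤ z → w * y ≤ x * z
  *-mono-≤ 0≤w 0≤z w≤x y≤z = ≤-trans (*-monoʳ-≤ 0≤w y≤z) (*-monoˡ-≤ 0≤z w≤x)

  square-nonNeg : ∀ x → 0# ≤ x * x
  square-nonNeg x with total 0# x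
  ... | inj₁ 0≤x = *-nonNeg 0≤x 0≤x
  ... | inj₂ x≤0 with t , 0≤t , 0≈x+t ← ≤⇒∃+ x≤0 = begin
    0#                     ≤⟨ *-nonNeg 0≤t 0≤t ⟩
    t * t                  ≈⟨ +-identityʳ _ ⟨
    -- Here `t` plays the role of `- x`: adding `x * (x + t)` and removing `(x + t) * t`, both zero,
    -- turns `t * t` into `x * x`.
    t * t + 0#             ≈⟨ +-congˡ (zeroʳ x) ⟨
    t * t + x * 0#         ≈⟨ +-congˡ (*-congˡ 0≈x+t) ⟩
    t * t + x * (x + t)    ≈⟨ solve 2 (λ x t → t :* t :+ x :* (x :+ t) := x :* x :+ (x :+ t) :* t) refl x t ⟩
    x * x + (x + t) * t    ≈⟨ +-congˡ (*-congʳ 0≈x+t) ⟨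
    x * x + 0# * t         ≈⟨ +-congˡ (zeroˡ t) ⟩
    x * x + 0#             ≈⟨ +-identityʳ _ ⟩
    x * x                  ∎

  0≤1 : 0# ≤ 1#
  0≤1 = ≤-trans (square-nonNeg 1#) (≤-reflexive (*-identityˡ 1#))

  *-inverseˡ : ¬ (x ≈ 0#) → x ⁻¹ * x ≈ 1#
  *-inverseˡ {x} x≉0 = trans (*-comm (x ⁻¹) x) (*-inverseʳ x≉0)

  -- The inverse equals `x` times the square of the inverse.
  ⁻¹-nonNeg : 0# ≤ x → ¬ (x ≈ 0#) → 0# ≤ x ⁻¹
  ⁻¹-nonNeg {x} 0≤x x≉0 = begin
    0#                   ≤⟨ *-nonNeg 0≤x (square-nonNeg (x ⁻¹)) ⟩
    x * (x ⁻¹ * x ⁻¹)    ≈⟨ *-assoc x _ _ ⟨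
    x * x ⁻¹ * x ⁻¹      ≈⟨ *-congʳ (*-inverseʳ x≉0) ⟩
    1# * x ⁻¹            ≈⟨ *-identityˡ _ ⟩
    x ⁻¹                 ∎

  square≤0⇒≈0 : x * x ≤ 0# → x ≈ 0#
  square≤0⇒≈0 {x} x²≤0 with x ≟ 0#
  ... | yes x≈0 = x≈0
  ... | no  x≉0 = begin-equality
    x                ≈⟨ *-identityˡ x ⟨
    1# * x           ≈⟨ *-congʳ (*-inverseˡ x≉0) ⟨
    x ⁻¹ * x * x     ≈⟨ *-assoc _ _ _ ⟩
    x ⁻¹ * (x * x)   ≈⟨ *-congˡ (antisym x²≤0 (square-nonNeg x)) ⟩
    x ⁻¹ * 0#        ≈⟨ zeroʳ _ ⟩
    0#               ∎

  -- Cancels a factor `x` that may be zero. If `x ≈ y + t` with `t` nonnegative, the hypothesis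
  -- forces `t * t ≤ 0#`, hence `t ≈ 0#`.
  x*x≤y*x⇒x≤y : 0# ≤ y → x * x ≤ y * x → x ≤ y
  x*x≤y*x⇒x≤y {y} {x} 0≤y x²≤yx with total x y
  ... | inj₁ x≤y = x≤y
  ... | inj₂ y≤x with t , 0≤t , x≈y+t ← ≤⇒∃+ y≤x = begin
    x       ≈⟨ x≈y+t ⟩
    y + t   ≈⟨ +-congˡ (square≤0⇒≈0 t²≤0) ⟩
    y + 0#  ≈⟨ +-identityʳ y ⟩
    y       ∎
    where
    t²≤0 : t * t ≤ 0#
    t²≤0 = +-cancelˡ-≤ (y * x) $ begin
      y * x + t * t          ≤⟨ x≤x+y (*-nonNeg 0≤t 0≤y) ⟩
      y * x + t * t + t * y  ≈⟨ solve 3 (λ x y t → y :* x :+ t :* t :+ t :* y := y :* x :+ t :* (y :+ t)) refl x y t ⟩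
      y * x + t * (y + t)    ≈⟨ +-congˡ (*-congˡ x≈y+t) ⟨
      y * x + t * x          ≈⟨ distribʳ x y t ⟨
      (y + t) * x            ≈⟨ *-congʳ x≈y+t ⟨
      x * x                  ≤⟨ x²≤yx ⟩
      y * x                  ≈⟨ +-identityʳ _ ⟨
      y * x + 0#             ∎

  square-cancel-≤ : 0# ≤ y → x * x ≤ y * y → x ≤ y
  square-cancel-≤ {y} {x} 0≤y x²≤y² with total x y
  ... | inj₁ x≤y = x≤y
  ... | inj₂ y≤x = x*x≤y*x⇒x≤y 0≤y (≤-trans x²≤y² (*-monoʳ-≤ 0≤y y≤x))

  -- Writing the larger number as the smaller plus `t`, the two sides differ by exactly `t * t`.
  2xy≤x²+y² : ∀ x y → x * y + x * y ≤ x * x + y * y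
  2xy≤x²+y² x y with total x y
  ... | inj₁ x≤y with t , _ , y≈x+t ← ≤⇒∃+ x≤y = begin
    x * y + x * y                        ≈⟨ +-cong (*-congˡ y≈x+t) (*-congˡ y≈x+t) ⟩
    x * (x + t) + x * (x + t)            ≤⟨ x≤x+y (square-nonNeg t) ⟩
    x * (x + t) + x * (x + t) + t * t    ≈⟨ solve 2 (λ x t → x :* (x :+ t) :+ x :* (x :+ t) :+ t :* t
                                                        := x :* x :+ (x :+ t) :* (x :+ t)) refl x t ⟩
    x * x + (x + t) * (x + t)            ≈⟨ +-congˡ (*-cong y≈x+t y≈x+t) ⟨
    x * x + y * y                        ∎
  ... | inj₂ y≤x with t , _ , x≈y+t ← ≤⇒∃+ y≤x = begin
    x * y + x * y                        ≈⟨ +-cong (*-congʳ x≈y+t) (*-congʳ x≈y+t) ⟩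
    (y + t) * y + (y + t) * y            ≤⟨ x≤x+y (square-nonNeg t) ⟩
    (y + t) * y + (y + t) * y + t * t    ≈⟨ solve 2 (λ y t → (y :+ t) :* y :+ (y :+ t) :* y :+ t :* t
                                                        := (y :+ t) :* (y :+ t) :+ y :* y) refl y t ⟩
    (y + t) * (y + t) + y * y            ≈⟨ +-congʳ (*-cong x≈y+t x≈y+t) ⟨
    x * x + y * y                        ∎

  -- After squaring, the cross term is twice `(a * d) * (b * c)`, at most the sum of the two
  -- squares, and the result factors. Bounding by `p` and `q` fits both the induction on dimension
  -- and the recombination of the two parts of a function on fibres.
  cauchySchwarz₂ : ∀ {p q a b c d} → 0# ≤ p → 0# ≤ q →
    a * a + b * b ≤ p * p → c * c + d * d ≤ q * q → a * c + b * d ≤ p * q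
  cauchySchwarz₂ {p} {q} {a} {b} {c} {d} 0≤p 0≤q ab≤p cd≤q = square-cancel-≤ (*-nonNeg 0≤p 0≤q) $ begin
    (a * c + b * d) * (a * c + b * d)
      ≈⟨ solve 4 (λ a b c d → (a :* c :+ b :* d) :* (a :* c :+ b :* d)
           := (a :* c) :* (a :* c) :+ (b :* d) :* (b :* d) :+ ((a :* d) :* (b :* c) :+ (a :* d) :* (b :* c)))
           refl a b c d ⟩
    (a * c) * (a * c) + (b * d) * (b * d) + ((a * d) * (b * c) + (a * d) * (b * c))
      ≤⟨ +-monoʳ-≤ _ (2xy≤x²+y² (a * d) (b * c)) ⟩
    (a * c) * (a * c) + (b * d) * (b * d) + ((a * d) * (a * d) + (b * c) * (b * c))
      ≈⟨ solve 4 (λ a b c d →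
           (a :* c) :* (a :* c) :+ (b :* d) :* (b :* d) :+ ((a :* d) :* (a :* d) :+ (b :* c) :* (b :* c))
           := (a :* a :+ b :* b) :* (c :* c :+ d :* d)) refl a b c d ⟩
    (a * a + b * b) * (c * c + d * d)
      ≤⟨ *-mono-≤ (+-nonNeg (square-nonNeg a) (square-nonNeg b)) (square-nonNeg q) ab≤p cd≤q ⟩
    p * p * (q * q)
      ≈⟨ solve 2 (λ p q → p :* p :* (q :* q) := p :* q :* (p :* q)) refl p q ⟩
    p * q * (p * q) ∎

  -- Finite sums

  sum-mono-≤ : {α β : Vector Carrier n} → (∀ i → α i ≤ β i) → sum α ≤ sum β
  sum-mono-≤ {zero}  α≤β = ≤-refl
  sum-mono-≤ {suc n} α≤β = +-mono-≤ (α≤β zero) (sum-mono-≤ (α≤β ∘ suc))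

  sum-nonNeg : {α : Vector Carrier n} → (∀ i → 0# ≤ α i) → 0# ≤ sum α
  sum-nonNeg {zero}  0≤α = ≤-refl
  sum-nonNeg {suc n} 0≤α = +-nonNeg (0≤α zero) (sum-nonNeg (0≤α ∘ suc))

  sum-const : ∀ n x → sum {n} (λ _ → x) ≈ fromℕ n * x
  sum-const zero    x = sym (zeroˡ x)
  sum-const (suc n) x = begin-equality
    x + sum {n} (λ _ → x)    ≈⟨ +-cong (sym (*-identityˡ x)) (sum-const n x) ⟩
    1# * x + fromℕ n * x     ≈⟨ distribʳ x 1# (fromℕ n) ⟨
    (1# + fromℕ n) * x       ∎

  fromℕ-nonNeg : ∀ n → 0# ≤ fromℕ n
  fromℕ-nonNeg zero    = ≤-refl
  fromℕ-nonNeg (suc n) = +-nonNeg 0≤1 (fromℕ-nonNeg n)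

  fromℕ≉0 : ∀ n .{{_ : NonZero n}} → ¬ (fromℕ n ≈ 0#)
  fromℕ≉0 (suc n) 1+n≈0 = 1≉0 $ antisym (begin
    1#            ≤⟨ x≤x+y (fromℕ-nonNeg n) ⟩
    1# + fromℕ n  ≈⟨ 1+n≈0 ⟩
    0#            ∎) 0≤1

  fromℕ-inverseˡ : ∀ n .{{_ : NonZero n}} x → fromℕ n ⁻¹ * (fromℕ n * x) ≈ x
  fromℕ-inverseˡ n x = begin-equality
    fromℕ n ⁻¹ * (fromℕ n * x)  ≈⟨ *-assoc _ _ _ ⟨
    fromℕ n ⁻¹ * fromℕ n * x    ≈⟨ *-congʳ (*-inverseˡ (fromℕ≉0 n)) ⟩
    1# * x                      ≈⟨ *-identityˡ x ⟩
    x                           ∎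

  fromℕ-inverseʳ : ∀ n .{{_ : NonZero n}} x → fromℕ n * (fromℕ n ⁻¹ * x) ≈ x
  fromℕ-inverseʳ n x = begin-equality
    fromℕ n * (fromℕ n ⁻¹ * x)  ≈⟨ solve 3 (λ a b x → a :* (b :* x) := b :* (a :* x)) refl _ _ _ ⟩
    fromℕ n ⁻¹ * (fromℕ n * x)  ≈⟨ fromℕ-inverseˡ n x ⟩
    x                           ∎

  -- Splits the normalization of the product, whose degree is `D₂ * D₂`, into those of two walks on
  -- `G₂`. Inserting `m` and `n` with their inverses produces a factor `mn` that cancels.
  fromℕ⁻¹-* : ∀ m n .{{_ : NonZero m}} .{{_ : NonZero n}} x →
    fromℕ (m ℕ.* n) ⁻¹ * x ≈ fromℕ m ⁻¹ * (fromℕ n ⁻¹ * x)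
  fromℕ⁻¹-* m n x = begin-equality
    mn ⁻¹ * x                            ≈⟨ *-congˡ (fromℕ-inverseʳ m x) ⟨
    mn ⁻¹ * (fromℕ m * (fromℕ m ⁻¹ * x)) ≈⟨ *-congˡ (*-congˡ (fromℕ-inverseʳ n _)) ⟨
    mn ⁻¹ * (fromℕ m * (fromℕ n * s))    ≈⟨ *-congˡ (*-assoc _ _ _) ⟨
    mn ⁻¹ * (fromℕ m * fromℕ n * s)      ≈⟨ *-congˡ (*-congʳ (×1-homo-* m n)) ⟨
    mn ⁻¹ * (mn * s)                     ≈⟨ fromℕ-inverseˡ (m ℕ.* n) {{ℕ.m*n≢0 m n}} s ⟩
    s                                    ≈⟨ solve 3 (λ a b x → b :* (a :* x) := a :* (b :* x)) refl _ _ _ ⟩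
    fromℕ m ⁻¹ * (fromℕ n ⁻¹ * x)        ∎
    where
    mn = fromℕ (m ℕ.* n)
    s  = fromℕ n ⁻¹ * (fromℕ m ⁻¹ * x)

  sum-↑ : ∀ m (α : Vector Carrier (m ℕ.+ n)) → sum α ≈ sum (λ i → α (i ↑ˡ n)) + sum (λ j → α (m ↑ʳ j))
  sum-↑ zero    α = sym (+-identityˡ _)
  sum-↑ (suc m) α = trans (+-congˡ (sum-↑ m (α ∘ suc))) (sym (+-assoc _ _ _))

  ∑∑ : (Fin m × Fin n → Carrier) → Carrier
  ∑∑ f = sum (λ i → sum (λ j → f (i , j)))

  ∑∑-cong : {f g : Fin m × Fin n → Carrier} → (∀ x → f x ≈ g x) → ∑∑ f ≈ ∑∑ g
  ∑∑-cong f≈g = sum-cong-≋ (λ i → sum-cong-≋ (λ j → f≈g (i , j)))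

  ∑∑-distrib-+ : (f g : Fin m × Fin n → Carrier) → ∑∑ (λ x → f x + g x) ≈ ∑∑ f + ∑∑ g
  ∑∑-distrib-+ f g = trans (sum-cong-≋ (λ i → ∑-distrib-+ (λ j → f (i , j)) (λ j → g (i , j))))
    (∑-distrib-+ (λ i → sum (λ j → f (i , j))) (λ i → sum (λ j → g (i , j))))

  ∑∑-mono-≤ : {f g : Fin m × Fin n → Carrier} → (∀ x → f x ≤ g x) → ∑∑ f ≤ ∑∑ g
  ∑∑-mono-≤ f≤g = sum-mono-≤ (λ i → sum-mono-≤ (λ j → f≤g (i , j)))

  ∑∑-proj₁ : (α : Vector Carrier m) → ∑∑ {m} {n} (α ∘ proj₁) ≈ fromℕ n * sum α
  ∑∑-proj₁ {n = n} α = trans (sum-cong-≋ (λ i → sum-const n (α i))) (sym (*-distribˡ-sum (fromℕ n) α))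

  sum-combine : ∀ m (α : Vector Carrier (m ℕ.* n)) → sum α ≈ ∑∑ {m} {n} (λ x → α (uncurry combine x))
  sum-combine     zero    α = refl
  sum-combine {n} (suc m) α = trans (sum-↑ n α) (+-congˡ (sum-combine m (λ j → α (n ↑ʳ j))))

  sum-remQuot : (f : Fin m × Fin n → Carrier) → sum (f ∘ remQuot {m} n) ≈ ∑∑ f
  sum-remQuot {m} {n} f = trans (sum-combine m _)
    (∑∑-cong (λ (i , j) → reflexive (≡.cong f (Fin.remQuot-combine i j))))

  -- Reindexes along a rotation map: conjugating `ρ` by the enumeration of pairs gives a permutation
  -- `σ` of one finite set, and a single sum is invariant under it.
  ∑∑-involution : {ρ : Fin m × Fin n → Fin m × Fin n} → (∀ x → ρ (ρ x) ≡ x) →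
    (f : Fin m × Fin n → Carrier) → ∑∑ f ≈ ∑∑ (f ∘ ρ)
  ∑∑-involution {m} {n} {ρ} ρ-involutive f = begin-equality
    ∑∑ f                          ≈⟨ sum-remQuot f ⟨
    sum (f ∘ dec)                 ≈⟨ sum-permute (f ∘ dec) (Permutation.permutation σ σ σ-involutive σ-involutive) ⟩
    sum (f ∘ dec ∘ σ)             ≈⟨ sum-cong-≋ (λ i → reflexive (≡.cong f (dec-enc (ρ (dec i))))) ⟩
    sum (f ∘ ρ ∘ dec)             ≈⟨ sum-remQuot (f ∘ ρ) ⟩
    ∑∑ (f ∘ ρ)                    ∎
    where
    dec : Fin (m ℕ.* n) → Fin m × Fin n
    dec = remQuot n
    enc : Fin m × Fin n → Fin (m ℕ.* n)
    enc = uncurry combine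
    dec-enc : ∀ x → dec (enc x) ≡ x
    dec-enc (i , j) = Fin.remQuot-combine i j
    σ : Fin (m ℕ.* n) → Fin (m ℕ.* n)
    σ = enc ∘ ρ ∘ dec
    σ-involutive : ∀ i → σ (σ i) ≡ i
    σ-involutive i = ≡.trans (≡.cong (enc ∘ ρ) (dec-enc (ρ (dec i))))
      (≡.trans (≡.cong enc (ρ-involutive (dec i))) (Fin.combine-remQuot {m} n i))

  -- Euclidean norms

  ⟨⟩-cong : {α α′ β β′ : Vector Carrier n} → (∀ i → α i ≈ α′ i) → (∀ i → β i ≈ β′ i) → ⟨ α , β ⟩ ≈ ⟨ α′ , β′ ⟩
  ⟨⟩-cong α≈ β≈ = sum-cong-≋ (λ i → *-cong (α≈ i) (β≈ i))

  ⟨α,α⟩-nonNeg : (α : Vector Carrier n) → 0# ≤ ⟨ α , α ⟩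
  ⟨α,α⟩-nonNeg α = sum-nonNeg (λ i → square-nonNeg (α i))

  ⟨α,α⟩≈0⇒α≈0 : (α : Vector Carrier n) → ⟨ α , α ⟩ ≈ 0# → ∀ i → α i ≈ 0#
  ⟨α,α⟩≈0⇒α≈0 α eq zero = square≤0⇒≈0 $
    ≤-trans (x≤x+y (⟨α,α⟩-nonNeg (α ∘ suc))) (≤-reflexive eq)
  ⟨α,α⟩≈0⇒α≈0 α eq (suc i) = ⟨α,α⟩≈0⇒α≈0 (α ∘ suc) (antisym tail≤0 (⟨α,α⟩-nonNeg (α ∘ suc))) i
    where
    tail≤0 : ⟨ α ∘ suc , α ∘ suc ⟩ ≤ 0#
    tail≤0 = ≤-trans (x≤x+y (square-nonNeg (α zero))) (≤-reflexive (trans (+-comm _ _) eq))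

  ∥∥-nonNeg : (α : Vector Carrier n) → 0# ≤ ∥ α ∥
  ∥∥-nonNeg α = √-nonNeg (⟨α,α⟩-nonNeg α)

  ∥∥-square : (α : Vector Carrier n) → ∥ α ∥ * ∥ α ∥ ≈ ⟨ α , α ⟩
  ∥∥-square α = √-square (⟨α,α⟩-nonNeg α)

  ∥∥-≤ : 0# ≤ x → (α : Vector Carrier n) → ⟨ α , α ⟩ ≤ x * x → ∥ α ∥ ≤ x
  ∥∥-≤ 0≤x α ⟨α,α⟩≤x² = square-cancel-≤ 0≤x (≤-trans (≤-reflexive (∥∥-square α)) ⟨α,α⟩≤x²)

  ∥∥-≤⁻¹ : (α : Vector Carrier n) → ∥ α ∥ ≤ x → ⟨ α , α ⟩ ≤ x * x
  ∥∥-≤⁻¹ α ∥α∥≤x = ≤-trans (≤-reflexive (sym (∥∥-square α)))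
    (*-mono-≤ (∥∥-nonNeg α) (≤-trans (∥∥-nonNeg α) ∥α∥≤x) ∥α∥≤x ∥α∥≤x)

  ∥∥-mono : (α : Vector Carrier m) (β : Vector Carrier n) → ⟨ α , α ⟩ ≤ ⟨ β , β ⟩ → ∥ α ∥ ≤ ∥ β ∥
  ∥∥-mono α β le = ∥∥-≤ (∥∥-nonNeg β) α (≤-trans le (≤-reflexive (sym (∥∥-square β))))

  ∥∥-cong : {α β : Vector Carrier n} → (∀ i → α i ≈ β i) → ∥ α ∥ ≈ ∥ β ∥
  ∥∥-cong {α = α} {β} α≈β = antisym (∥∥-mono α β (≤-reflexive eq)) (∥∥-mono β α (≤-reflexive (sym eq)))
    where
    eq : ⟨ α , α ⟩ ≈ ⟨ β , β ⟩
    eq = ⟨⟩-cong α≈β α≈β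

  ∥∥≉0 : (α : Vector Carrier n) → ¬ (∀ i → α i ≈ 0#) → ¬ (∥ α ∥ ≈ 0#)
  ∥∥≉0 α α≉0 ∥α∥≈0 = α≉0 (⟨α,α⟩≈0⇒α≈0 α (begin-equality
    ⟨ α , α ⟩      ≈⟨ ∥∥-square α ⟨
    ∥ α ∥ * ∥ α ∥  ≈⟨ *-congʳ ∥α∥≈0 ⟩
    0# * ∥ α ∥     ≈⟨ zeroˡ _ ⟩
    0#             ∎))

  -- Induction on the dimension: the step is the planar inequality for the vectors formed by the
  -- head and the norm of the tail.
  cauchySchwarz : (α β : Vector Carrier n) → ⟨ α , β ⟩ ≤ ∥ α ∥ * ∥ β ∥
  cauchySchwarz {zero}  α β = *-nonNeg (∥∥-nonNeg α) (∥∥-nonNeg β)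
  cauchySchwarz {suc n} α β = begin
    α zero * β zero + ⟨ α′ , β′ ⟩      ≤⟨ +-monoʳ-≤ _ (cauchySchwarz α′ β′) ⟩
    α zero * β zero + ∥ α′ ∥ * ∥ β′ ∥  ≤⟨ cauchySchwarz₂ (∥∥-nonNeg α) (∥∥-nonNeg β) (pythagoras α) (pythagoras β) ⟩
    ∥ α ∥ * ∥ β ∥                      ∎
    where
    α′ β′ : Vector Carrier n
    α′ = α ∘ suc
    β′ = β ∘ suc
    pythagoras : (γ : Vector Carrier (suc n)) → γ zero * γ zero + ∥ γ ∘ suc ∥ * ∥ γ ∘ suc ∥ ≤ ∥ γ ∥ * ∥ γ ∥
    pythagoras γ = ≤-reflexive (trans (+-congˡ (∥∥-square (γ ∘ suc))) (sym (∥∥-square γ)))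

  -- Random walks

  -- The normalized adjacency operator as an average over the edges at `u`, without edge counts;
  -- `adjacency-⊛` identifies the two.
  walk : Graph N D → Vector Carrier N → Vector Carrier N
  walk {D = D} G α u = fromℕ D ⁻¹ * sum (λ i → α (proj₁ (rot G (u , i))))

  -- Edge counts as sums of indicators

  indicator : ∀ {a} {A : Set a} → Dec A → Carrier
  indicator P? = if does P? then 1# else 0#

  fromℕ-length-filter-tabulate : ∀ {a p} {A : Set a} {P : Pred A p} (P? : Decidable P) (f : Fin n → A) →
    fromℕ (length (filter P? (tabulate f))) ≈ sum (λ i → indicator (P? (f i)))
  fromℕ-length-filter-tabulate {zero}  P? f = refl
  fromℕ-length-filter-tabulate {suc n} P? f with ih ← fromℕ-length-filter-tabulate P? (f ∘ suc) | does (P? (f zero))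
  ... | true  = +-congˡ ih
  ... | false = trans ih (sym (+-identityˡ _))

  -- Makes `edgeCount` summable. The enumeration `f` is arbitrary so that the induction can pass to
  -- `f ∘ suc`.
  fromℕ-length-filter-cartesianProduct : ∀ {a p} {A : Set a} {P : Pred (A × Fin n) p} (P? : Decidable P)
    (f : Fin m → A) →
    fromℕ (length (filter P? (cartesianProduct (tabulate f) (allFin n)))) ≈ ∑∑ (λ (i , j) → indicator (P? (f i , j)))
  fromℕ-length-filter-cartesianProduct {m = zero}  P? f = refl
  fromℕ-length-filter-cartesianProduct {n} {suc m} P? f = begin-equality
    fromℕ (length (filter P? (row ++ rest)))
      ≡⟨ ≡.cong fromℕ (≡.trans (≡.cong length (List.filter-++ P? row rest)) (List.length-++ (filter P? row))) ⟩
    fromℕ (length (filter P? row) ℕ.+ length (filter P? rest))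
      ≈⟨ ×-homo-+ 1# (length (filter P? row)) _ ⟩
    fromℕ (length (filter P? row)) + fromℕ (length (filter P? rest))
      ≡⟨ ≡.cong (λ xs → fromℕ (length (filter P? xs)) + fromℕ (length (filter P? rest)))
           (List.map-tabulate id (f zero ,_)) ⟩
    fromℕ (length (filter P? (tabulate (f zero ,_)))) + fromℕ (length (filter P? rest))
      ≈⟨ +-cong (fromℕ-length-filter-tabulate P? (f zero ,_)) (fromℕ-length-filter-cartesianProduct P? (f ∘ suc)) ⟩
    ∑∑ (λ (i , j) → indicator (P? (f i , j))) ∎
    where
    row rest : List _
    row  = map (f zero ,_) (allFin n)
    rest = cartesianProduct (tabulate (f ∘ suc)) (allFin n)

  sum-indicator : (w : Fin n) (α : Vector Carrier n) → sum (λ v → indicator (w Fin.≟ v) * α v) ≈ α w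
  sum-indicator {suc n} zero    α = begin-equality
    1# * α zero + sum (λ v → 0# * α (suc v))  ≈⟨ +-cong (*-identityˡ _) (sym (*-distribˡ-sum 0# (α ∘ suc))) ⟩
    α zero + 0# * sum (α ∘ suc)               ≈⟨ +-congˡ (zeroˡ _) ⟩
    α zero + 0#                               ≈⟨ +-identityʳ _ ⟩
    α zero                                    ∎
  sum-indicator {suc n} (suc w) α = begin-equality
    0# * α zero + sum (λ v → indicator (w Fin.≟ v) * α (suc v)) ≈⟨ +-cong (zeroˡ _) (sum-indicator w (α ∘ suc)) ⟩
    0# + α (suc w)                                              ≈⟨ +-identityˡ _ ⟩
    α (suc w)                                                   ∎

  ∑∑-indicator : (x : Fin m × Fin n) (α : Vector Carrier m) →
    ∑∑ (λ y → indicator (≡-dec Fin._≟_ Fin._≟_ x y) * α (proj₁ y)) ≈ α (proj₁ x)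
  ∑∑-indicator {m} {n} (w , l) α = trans (sum-cong-≋ row) (sum-indicator w α)
    where
    row : ∀ v → sum (λ j → indicator (≡-dec Fin._≟_ Fin._≟_ (w , l) (v , j)) * α v) ≈ indicator (w Fin.≟ v) * α v
    row v with w Fin.≟ v
    ... | yes ≡.refl = trans (sum-indicator l (λ _ → α v)) (sym (*-identityˡ (α v)))
    ... | no _       = trans (sym (*-distribˡ-sum {n} 0# (λ _ → α v))) (trans (zeroˡ _) (sym (zeroˡ (α v))))

  -- Expand every edge count into indicators and move the sum over `i` outermost. For fixed `u` and
  -- `i` exactly one pair `(v , j)` equals `rot G (u , i)`, so the rest collapses to the value at
  -- that neighbour.
  adjacency-⊛ : (G : Graph N D) (α : Vector Carrier N) → ∀ u → (adjacency G ⊛ α) u ≈ walk G α u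
  adjacency-⊛ {N} {D} G α u = begin-equality
    sum (λ v → fromℕ (edgeCount G u v) / d * α v)
      ≈⟨ sum-cong-≋ (λ v → trans (solve 3 (λ e d a → e :* d :* a := d :* (e :* a)) refl _ _ _) (*-congˡ (expand v))) ⟩
    sum (λ v → d ⁻¹ * sum (λ i → sum (λ j → δ v (i , j) * α v)))
      ≈⟨ *-distribˡ-sum (d ⁻¹) (λ v → sum (λ i → sum (λ j → δ v (i , j) * α v))) ⟨
    d ⁻¹ * sum (λ v → sum (λ i → sum (λ j → δ v (i , j) * α v)))
      ≈⟨ *-congˡ (∑-comm (λ v i → sum (λ j → δ v (i , j) * α v))) ⟩
    d ⁻¹ * sum (λ i → ∑∑ (λ (v , j) → δ v (i , j) * α v))
      ≈⟨ *-congˡ (sum-cong-≋ (λ i → ∑∑-indicator (rot G (u , i)) α)) ⟩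
    walk G α u ∎
    where
    d = fromℕ D
    δ : Fin N → Fin D × Fin D → Carrier
    δ v (i , j) = indicator (≡-dec Fin._≟_ Fin._≟_ (rot G (u , i)) (v , j))
    expand : ∀ v → fromℕ (edgeCount G u v) * α v ≈ sum (λ i → sum (λ j → δ v (i , j) * α v))
    expand v = begin-equality
      fromℕ (edgeCount G u v) * α v
        ≈⟨ *-congʳ (fromℕ-length-filter-cartesianProduct
             (λ (i , j) → ≡-dec Fin._≟_ Fin._≟_ (rot G (u , i)) (v , j)) id) ⟩
      ∑∑ (δ v) * α v
        ≈⟨ *-distribʳ-sum (α v) (λ i → sum (λ j → δ v (i , j))) ⟩
      sum (λ i → sum (λ j → δ v (i , j)) * α v)
        ≈⟨ sum-cong-≋ (λ i → *-distribʳ-sum (α v) (λ j → δ v (i , j))) ⟩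
      sum (λ i → sum (λ j → δ v (i , j) * α v)) ∎

  -- Linearity, self-adjointness and contraction of the walk

  walk-cong : (G : Graph N D) {α β : Vector Carrier N} → (∀ i → α i ≈ β i) → ∀ u → walk G α u ≈ walk G β u
  walk-cong G α≈β u = *-congˡ (sum-cong-≋ (λ i → α≈β (proj₁ (rot G (u , i)))))

  walk-const+ : .{{_ : NonZero D}} (G : Graph N D) (x : Carrier) (α : Vector Carrier N) →
    ∀ u → walk G (λ v → x + α v) u ≈ x + walk G α u
  walk-const+ {D} G x α u = begin-equality
    d ⁻¹ * sum (λ i → x + α′ i)                 ≈⟨ *-congˡ (∑-distrib-+ (λ _ → x) α′) ⟩
    d ⁻¹ * (sum {D} (λ _ → x) + sum α′)         ≈⟨ distribˡ _ _ _ ⟩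
    d ⁻¹ * sum {D} (λ _ → x) + walk G α u       ≈⟨ +-congʳ (*-congˡ (sum-const D x)) ⟩
    d ⁻¹ * (d * x) + walk G α u                 ≈⟨ +-congʳ (fromℕ-inverseˡ D x) ⟩
    x + walk G α u                              ∎
    where
    d  = fromℕ D
    α′ : Vector Carrier D
    α′ i = α (proj₁ (rot G (u , i)))

  -- Turns the form into a sum over pairs of a vertex and an edge label, the set that `rot G`
  -- permutes.
  ⟨walk,⟩ : (G : Graph N D) (α β : Vector Carrier N) →
    ⟨ walk G α , β ⟩ ≈ fromℕ D ⁻¹ * ∑∑ (λ x → α (proj₁ (rot G x)) * β (proj₁ x))
  ⟨walk,⟩ {N} {D} G α β = begin-equality
    sum (λ u → d ⁻¹ * sum (α′ u) * β u)          ≈⟨ sum-cong-≋ (λ u → *-assoc (d ⁻¹) (sum (α′ u)) (β u)) ⟩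
    sum (λ u → d ⁻¹ * (sum (α′ u) * β u))        ≈⟨ *-distribˡ-sum (d ⁻¹) (λ u → sum (α′ u) * β u) ⟨
    d ⁻¹ * sum (λ u → sum (α′ u) * β u)          ≈⟨ *-congˡ (sum-cong-≋ (λ u → *-distribʳ-sum (β u) (α′ u))) ⟩
    d ⁻¹ * sum (λ u → sum (λ i → α′ u i * β u))  ∎
    where
    d  = fromℕ D
    α′ : Fin N → Vector Carrier D
    α′ u i = α (proj₁ (rot G (u , i)))

  ⟨⟩-comm : (α β : Vector Carrier n) → ⟨ α , β ⟩ ≈ ⟨ β , α ⟩
  ⟨⟩-comm α β = sum-cong-≋ (λ i → *-comm (α i) (β i))

  -- Reindexing by the rotation map exchanges the two ends of every edge.
  walk-selfAdjoint : (G : Graph N D) (α β : Vector Carrier N) → ⟨ walk G α , β ⟩ ≈ ⟨ α , walk G β ⟩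
  walk-selfAdjoint {D = D} G α β = begin-equality
    ⟨ walk G α , β ⟩
      ≈⟨ ⟨walk,⟩ G α β ⟩
    d ⁻¹ * ∑∑ (λ x → α (proj₁ (rot G x)) * β (proj₁ x))
      ≈⟨ *-congˡ (∑∑-involution (rot-involutive G) (λ x → α (proj₁ (rot G x)) * β (proj₁ x))) ⟩
    d ⁻¹ * ∑∑ (λ x → α (proj₁ (rot G (rot G x))) * β (proj₁ (rot G x)))
      ≈⟨ *-congˡ (∑∑-cong (λ x → trans (*-comm _ _)
           (*-congˡ (reflexive (≡.cong (α ∘ proj₁) (rot-involutive G x)))))) ⟩
    d ⁻¹ * ∑∑ (λ x → β (proj₁ (rot G x)) * α (proj₁ x))
      ≈⟨ ⟨walk,⟩ G β α ⟨
    ⟨ walk G β , α ⟩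
      ≈⟨ ⟨⟩-comm (walk G β) α ⟩
    ⟨ α , walk G β ⟩ ∎
    where d = fromℕ D

  -- With `β = walk G α`, twice `⟨ β , β ⟩` is an average of terms `2xy`, one per edge end. Bounding
  -- each by `x² + y²` and reindexing the far ends gives at most `⟨ α , α ⟩ + ⟨ β , β ⟩`; one
  -- `⟨ β , β ⟩` then cancels.
  walk-nonExpansive : .{{_ : NonZero D}} (G : Graph N D) (α : Vector Carrier N) → ∥ walk G α ∥ ≤ ∥ α ∥
  walk-nonExpansive {D} {N} G α = ∥∥-mono β α (+-cancelˡ-≤ ⟨ β , β ⟩ (begin
    ⟨ β , β ⟩ + ⟨ β , β ⟩
      ≈⟨ +-cong (⟨walk,⟩ G α β) (⟨walk,⟩ G α β) ⟩
    d ⁻¹ * ∑∑ αβ + d ⁻¹ * ∑∑ αβ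
      ≈⟨ distribˡ _ _ _ ⟨
    d ⁻¹ * (∑∑ αβ + ∑∑ αβ)
      ≈⟨ *-congˡ (∑∑-distrib-+ αβ αβ) ⟨
    d ⁻¹ * ∑∑ (λ x → αβ x + αβ x)
      ≤⟨ *-monoʳ-≤ (⁻¹-nonNeg (fromℕ-nonNeg D) (fromℕ≉0 D))
           (∑∑-mono-≤ (λ x → 2xy≤x²+y² (α (proj₁ (rot G x))) (β (proj₁ x)))) ⟩
    d ⁻¹ * ∑∑ (λ x → α² (rot G x) + β² x)
      ≈⟨ *-congˡ (∑∑-distrib-+ (α² ∘ rot G) β²) ⟩
    d ⁻¹ * (∑∑ (α² ∘ rot G) + ∑∑ β²)
      ≈⟨ *-congˡ (+-congʳ (∑∑-involution (rot-involutive G) α²)) ⟨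
    d ⁻¹ * (∑∑ α² + ∑∑ β²)
      ≈⟨ *-congˡ (+-cong (∑∑-proj₁ {n = D} (λ u → α u * α u)) (∑∑-proj₁ {n = D} (λ u → β u * β u))) ⟩
    d ⁻¹ * (d * ⟨ α , α ⟩ + d * ⟨ β , β ⟩)
      ≈⟨ *-congˡ (distribˡ d ⟨ α , α ⟩ ⟨ β , β ⟩) ⟨
    d ⁻¹ * (d * (⟨ α , α ⟩ + ⟨ β , β ⟩))
      ≈⟨ fromℕ-inverseˡ D _ ⟩
    ⟨ α , α ⟩ + ⟨ β , β ⟩
      ≈⟨ +-comm _ _ ⟩
    ⟨ β , β ⟩ + ⟨ α , α ⟩ ∎))
    where
    d = fromℕ D
    β : Vector Carrier N
    β = walk G α
    αβ α² β² : Fin N × Fin D → Carrier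
    αβ x = α (proj₁ (rot G x)) * β (proj₁ x)
    α² x = α (proj₁ x) * α (proj₁ x)
    β² x = β (proj₁ x) * β (proj₁ x)

  -- The second eigenvalue

  -- The eigenvalue condition freed of quotient and supremum, with the zero vector included.
  SpectralBound : Graph N D → Carrier → Set _
  SpectralBound {N} G x = (α : Vector Carrier N) → sum α ≈ 0# → ∥ walk G α ∥ ≤ x * ∥ α ∥

  ⟨α,𝟙⟩≈sum : (α : Vector Carrier n) → ⟨ α , 𝟙 ⟩ ≈ sum α
  ⟨α,𝟙⟩≈sum α = sum-cong-≋ (λ i → *-identityʳ (α i))

  α≈0⇒∥α∥≈0 : (α : Vector Carrier n) → (∀ i → α i ≈ 0#) → ∥ α ∥ ≈ 0#
  α≈0⇒∥α∥≈0 {n} α α≈0 = antisym (∥∥-≤ ≤-refl α (≤-reflexive ⟨α,α⟩≈0)) (∥∥-nonNeg α)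
    where
    ⟨α,α⟩≈0 : ⟨ α , α ⟩ ≈ 0# * 0#
    ⟨α,α⟩≈0 = begin-equality
      ⟨ α , α ⟩                ≈⟨ ⟨⟩-cong α≈0 α≈0 ⟩
      sum {n} (λ _ → 0# * 0#)  ≈⟨ sum-const n (0# * 0#) ⟩
      fromℕ n * (0# * 0#)      ≈⟨ solve 1 (λ a → a :* (con 0 :* con 0) := con 0 :* con 0) refl (fromℕ n) ⟩
      0# * 0#                  ∎

  ∥α∥≈0⇒walk-bound : .{{_ : NonZero D}} (G : Graph N D) (α : Vector Carrier N) → ∥ α ∥ ≈ 0# → ∥ walk G α ∥ ≤ x * ∥ α ∥
  ∥α∥≈0⇒walk-bound {x = x} G α ∥α∥≈0 = begin
    ∥ walk G α ∥  ≤⟨ walk-nonExpansive G α ⟩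
    ∥ α ∥         ≈⟨ ∥α∥≈0 ⟩
    0#            ≈⟨ zeroʳ x ⟨
    x * 0#        ≈⟨ *-congˡ ∥α∥≈0 ⟨
    x * ∥ α ∥     ∎

  module _ (G : Graph N D) (α : Vector Carrier N) (∥α∥≉0 : ¬ (∥ α ∥ ≈ 0#)) where

    ∥⊛∥≈∥walk∥ : ∥ adjacency G ⊛ α ∥ ≈ ∥ walk G α ∥
    ∥⊛∥≈∥walk∥ = ∥∥-cong (adjacency-⊛ G α)

    walk-bound⇒ratio≤ : ∥ walk G α ∥ ≤ x * ∥ α ∥ → ∥ adjacency G ⊛ α ∥ / ∥ α ∥ ≤ x
    walk-bound⇒ratio≤ {x} le = begin
      ∥ adjacency G ⊛ α ∥ * ∥ α ∥ ⁻¹  ≈⟨ *-congʳ ∥⊛∥≈∥walk∥ ⟩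
      ∥ walk G α ∥ * ∥ α ∥ ⁻¹         ≤⟨ *-monoˡ-≤ (⁻¹-nonNeg (∥∥-nonNeg α) ∥α∥≉0) le ⟩
      x * ∥ α ∥ * ∥ α ∥ ⁻¹            ≈⟨ *-assoc _ _ _ ⟩
      x * (∥ α ∥ * ∥ α ∥ ⁻¹)          ≈⟨ *-congˡ (*-inverseʳ ∥α∥≉0) ⟩
      x * 1#                          ≈⟨ *-identityʳ x ⟩
      x                               ∎

    ratio≤⇒walk-bound : ∥ adjacency G ⊛ α ∥ / ∥ α ∥ ≤ x → ∥ walk G α ∥ ≤ x * ∥ α ∥
    ratio≤⇒walk-bound {x} le = begin
      ∥ walk G α ∥                            ≈⟨ ∥⊛∥≈∥walk∥ ⟨
      ∥ adjacency G ⊛ α ∥                     ≈⟨ *-identityʳ _ ⟨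
      ∥ adjacency G ⊛ α ∥ * 1#                ≈⟨ *-congˡ (*-inverseˡ ∥α∥≉0) ⟨
      ∥ adjacency G ⊛ α ∥ * (∥ α ∥ ⁻¹ * ∥ α ∥) ≈⟨ *-assoc _ _ _ ⟨
      ∥ adjacency G ⊛ α ∥ / ∥ α ∥ * ∥ α ∥     ≤⟨ *-monoˡ-≤ (∥∥-nonNeg α) le ⟩
      x * ∥ α ∥                               ∎

    ratio-nonNeg : 0# ≤ ∥ adjacency G ⊛ α ∥ / ∥ α ∥
    ratio-nonNeg = *-nonNeg (∥∥-nonNeg (adjacency G ⊛ α)) (⁻¹-nonNeg (∥∥-nonNeg α) ∥α∥≉0)

  -- A nonzero vector orthogonal to `𝟙`, available from two vertices on. It shows that the set of
  -- stretch ratios is inhabited, as the supremum axioms require.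
  e₀-e₁ : Vector Carrier (suc (suc n))
  e₀-e₁ zero          = 1#
  e₀-e₁ (suc zero)    = - 1#
  e₀-e₁ (suc (suc _)) = 0#

  sum-e₀-e₁ : sum (e₀-e₁ {n}) ≈ 0#
  sum-e₀-e₁ {n} = begin-equality
    1# + (- 1# + sum {n} (λ _ → 0#))  ≈⟨ +-congˡ (+-congˡ (trans (sum-const n 0#) (zeroʳ _))) ⟩
    1# + (- 1# + 0#)                  ≈⟨ +-congˡ (+-identityʳ _) ⟩
    1# + - 1#                         ≈⟨ -‿inverseʳ 1# ⟩
    0#                                ∎

  e₀-e₁≉0 : ¬ (∀ i → e₀-e₁ {n} i ≈ 0#)
  e₀-e₁≉0 ≈0 = 1≉0 (≈0 zero)

  module _ (G : Graph (suc (suc n)) D) where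

    e₀-e₁-ratio : StretchRatio G (∥ adjacency G ⊛ e₀-e₁ ∥ / ∥ e₀-e₁ {n} ∥)
    e₀-e₁-ratio = e₀-e₁ , trans (⟨α,𝟙⟩≈sum (e₀-e₁ {n})) (sum-e₀-e₁ {n}) , e₀-e₁≉0 , refl

    module _ .{{_ : NonZero D}} where

      ratio≤1 : ∀ {r} → StretchRatio G r → r ≤ 1#
      ratio≤1 (α , _ , α≉0 , r≈) = ≤-trans (≤-reflexive r≈) (walk-bound⇒ratio≤ G α (∥∥≉0 α α≉0)
        (≤-trans (walk-nonExpansive G α) (≤-reflexive (sym (*-identityˡ _)))))

      ratio≤secondEigenvalue : ∀ {r} → StretchRatio G r → r ≤ secondEigenvalue G
      -- The set is inhabited by the ratio of `e₀-e₁` and bounded by `1#`, since the walk does not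
      -- expand norms.
      ratio≤secondEigenvalue ratio = sup-upper (_ , lift e₀-e₁-ratio) (1# , λ (lift s) → ratio≤1 s) (lift ratio)

  -- A supremum of quotients of norms lies above the nonnegative ratio of `e₀-e₁`; for one vertex
  -- the value is `0#` by definition.
  secondEigenvalue-nonNeg : .{{_ : NonZero N}} .{{_ : NonZero D}} (G : Graph N D) → 0# ≤ secondEigenvalue G
  secondEigenvalue-nonNeg {suc zero}    G = ≤-refl
  secondEigenvalue-nonNeg {suc (suc n)} G =
    ≤-trans (ratio-nonNeg G e₀-e₁ (∥∥≉0 e₀-e₁ (e₀-e₁≉0 {n}))) (ratio≤secondEigenvalue G (e₀-e₁-ratio G))

  IsNDλGraph⇒SpectralBound : .{{_ : NonZero N}} .{{_ : NonZero D}} (G : Graph N D) →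
    IsNDλGraph N D x G → SpectralBound G x
  IsNDλGraph⇒SpectralBound {suc zero} G _ α Σα≈0 =
    -- On a single vertex, a vector with zero sum is the zero vector.
    ∥α∥≈0⇒walk-bound G α (α≈0⇒∥α∥≈0 α λ { zero → trans (sym (+-identityʳ _)) Σα≈0 })
  IsNDλGraph⇒SpectralBound {suc (suc _)} G λ≤x α Σα≈0 with ∥ α ∥ ≟ 0#
  ... | yes ∥α∥≈0 = ∥α∥≈0⇒walk-bound G α ∥α∥≈0
  ... | no  ∥α∥≉0 = ratio≤⇒walk-bound G α ∥α∥≉0
    (≤-trans (ratio≤secondEigenvalue G (α , trans (⟨α,𝟙⟩≈sum α) Σα≈0 , ∥α∥≉0 ∘ α≈0⇒∥α∥≈0 α , refl)) λ≤x)

  SpectralBound⇒IsNDλGraph : .{{_ : NonZero N}} (G : Graph N D) →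
    0# ≤ x → SpectralBound G x → IsNDλGraph N D x G
  -- Here `secondEigenvalue` takes its default `0#`, so the goal is the nonnegativity of `x`.
  SpectralBound⇒IsNDλGraph {suc zero}    G 0≤x _     = 0≤x
  SpectralBound⇒IsNDλGraph {suc (suc _)} G 0≤x bound = sup-least (_ , lift (e₀-e₁-ratio G))
    λ (lift (α , α⊥𝟙 , α≉0 , r≈)) → ≤-trans (≤-reflexive r≈)
      (walk-bound⇒ratio≤ G α (∥∥≉0 α α≉0) (bound α (trans (sym (⟨α,𝟙⟩≈sum α)) α⊥𝟙)))

  -- The zig-zag product

  -- Functions on pairs are measured along the enumeration remQuot, the one by
  -- which ⓩ flattens its vertex set.
  ⟪_,_⟫ : (f g : Fin m × Fin n → Carrier) → Carrier
  ⟪_,_⟫ {m} {n} f g = ⟨ f ∘ remQuot {m} n , g ∘ remQuot {m} n ⟩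

  ⟦_⟧ : (Fin m × Fin n → Carrier) → Carrier
  ⟦_⟧ {m} {n} f = ∥ f ∘ remQuot {m} n ∥

  ⟪⟫≈∑∑ : (f g : Fin m × Fin n → Carrier) → ⟪ f , g ⟫ ≈ ∑∑ (λ x → f x * g x)
  ⟪⟫≈∑∑ f g = sum-remQuot (λ x → f x * g x)

  ⟪⟫-cong : {f f′ g g′ : Fin m × Fin n → Carrier} → (∀ x → f x ≈ f′ x) → (∀ x → g x ≈ g′ x) → ⟪ f , g ⟫ ≈ ⟪ f′ , g′ ⟫
  ⟪⟫-cong {m} {n} f≈ g≈ = ⟨⟩-cong (λ i → f≈ (remQuot {m} n i)) (λ i → g≈ (remQuot {m} n i))

  ⟪⟫-expand : (f f′ g g′ : Fin m × Fin n → Carrier) →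
    ⟪ (λ x → f x + f′ x) , (λ x → g x + g′ x) ⟫ ≈ ⟪ f , g ⟫ + ⟪ f , g′ ⟫ + (⟪ f′ , g ⟫ + ⟪ f′ , g′ ⟫)
  ⟪⟫-expand f f′ g g′ = begin-equality
    ⟪ (λ x → f x + f′ x) , (λ x → g x + g′ x) ⟫
      ≈⟨ ⟪⟫≈∑∑ (λ x → f x + f′ x) (λ x → g x + g′ x) ⟩
    ∑∑ (λ x → (f x + f′ x) * (g x + g′ x))
      ≈⟨ ∑∑-cong (λ x → solve 4 (λ a b c d → (a :+ b) :* (c :+ d) := a :* c :+ a :* d :+ (b :* c :+ b :* d))
           refl (f x) (f′ x) (g x) (g′ x)) ⟩
    ∑∑ (λ x → f x * g x + f x * g′ x + (f′ x * g x + f′ x * g′ x))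
      ≈⟨ ∑∑-distrib-+ (λ x → f x * g x + f x * g′ x) (λ x → f′ x * g x + f′ x * g′ x) ⟩
    ∑∑ (λ x → f x * g x + f x * g′ x) + ∑∑ (λ x → f′ x * g x + f′ x * g′ x)
      ≈⟨ +-cong (∑∑-distrib-+ (λ x → f x * g x) (λ x → f x * g′ x))
                (∑∑-distrib-+ (λ x → f′ x * g x) (λ x → f′ x * g′ x)) ⟩
    ∑∑ (λ x → f x * g x) + ∑∑ (λ x → f x * g′ x) + (∑∑ (λ x → f′ x * g x) + ∑∑ (λ x → f′ x * g′ x))
      ≈⟨ +-cong (+-cong (⟪⟫≈∑∑ f g) (⟪⟫≈∑∑ f g′)) (+-cong (⟪⟫≈∑∑ f′ g) (⟪⟫≈∑∑ f′ g′)) ⟨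
    ⟪ f , g ⟫ + ⟪ f , g′ ⟫ + (⟪ f′ , g ⟫ + ⟪ f′ , g′ ⟫) ∎

  -- Each value is repeated along a fibre of size `n`; this carries norms on the vertices of `G₁`
  -- over to functions on pairs.
  ⟪∘proj₁⟫ : (α β : Vector Carrier m) → ⟪_,_⟫ {m} {n} (α ∘ proj₁) (β ∘ proj₁) ≈ fromℕ n * ⟨ α , β ⟩
  ⟪∘proj₁⟫ {m} {n} α β = trans (⟪⟫≈∑∑ {m} {n} (α ∘ proj₁) (β ∘ proj₁)) (∑∑-proj₁ {m} {n} (λ u → α u * β u))

  ⟪⟫≤ : (f g : Fin m × Fin n → Carrier) → ⟦ f ⟧ ≤ x → ⟦ g ⟧ ≤ y → ⟪ f , g ⟫ ≤ x * y
  ⟪⟫≤ {m} {n} f g f≤x g≤y = ≤-trans (cauchySchwarz f′ g′)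
    (*-mono-≤ (∥∥-nonNeg f′) (≤-trans (∥∥-nonNeg g′) g≤y) f≤x g≤y)
    where
    f′ g′ : Vector Carrier (m ℕ.* n)
    f′ = f ∘ remQuot {m} n
    g′ = g ∘ remQuot {m} n

  -- Composition with the rotation map only permutes the summands of the squared norm.
  ⟦∘rot⟧≤ : (G : Graph N D) (f : Fin N × Fin D → Carrier) → ⟦ f ∘ rot G ⟧ ≤ ⟦ f ⟧
  ⟦∘rot⟧≤ {N} {D} G f = ∥∥-mono (f ∘ rot G ∘ remQuot {N} D) (f ∘ remQuot {N} D) $ begin
    ⟪ f ∘ rot G , f ∘ rot G ⟫            ≈⟨ ⟪⟫≈∑∑ (f ∘ rot G) (f ∘ rot G) ⟩
    ∑∑ (λ x → f (rot G x) * f (rot G x)) ≈⟨ ∑∑-involution (rot-involutive G) (λ x → f x * f x) ⟨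
    ∑∑ (λ x → f x * f x)                 ≈⟨ ⟪⟫≈∑∑ f f ⟨
    ⟪ f , f ⟫                            ∎

  -- Means and deviations on fibres

  row : (Fin m × Fin n → Carrier) → Fin m → Vector Carrier n
  row f v k = f (v , k)

  -- `rowMean f ∘ proj₁` is the part f₀ of `f`, and `rowDeviation f` the part f₁.
  rowMean : (Fin m × Fin n → Carrier) → Vector Carrier m
  rowMean {n = n} f v = fromℕ n ⁻¹ * sum (row f v)

  rowDeviation : (Fin m × Fin n → Carrier) → Fin m × Fin n → Carrier
  rowDeviation f x = - rowMean f (proj₁ x) + f x

  -- The operator B, the tensor product of the identity with the adjacency operator of `G`.
  fibreWalk : Graph n D → (Fin m × Fin n → Carrier) → Fin m × Fin n → Carrier
  fibreWalk G f (v , k) = walk G (row f v) k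

  rowMean+rowDeviation : (f : Fin m × Fin n → Carrier) → ∀ x → f x ≈ rowMean f (proj₁ x) + rowDeviation f x
  rowMean+rowDeviation f x = begin-equality
    f x                       ≈⟨ +-identityˡ _ ⟨
    0# + f x                  ≈⟨ +-congʳ (-‿inverseʳ μ) ⟨
    μ + - μ + f x             ≈⟨ +-assoc μ (- μ) (f x) ⟩
    μ + (- μ + f x)           ∎
    where μ = rowMean f (proj₁ x)

  module _ {m n} .{{_ : NonZero n}} (f : Fin m × Fin n → Carrier) where

    -- Lets the bound for `G₁` be applied to the vector of means.
    sum-rowMean : sum (f ∘ remQuot {m} n) ≈ 0# → sum (rowMean f) ≈ 0#
    sum-rowMean Σf≈0 = begin-equality
      sum (λ v → fromℕ n ⁻¹ * sum (row f v))  ≈⟨ *-distribˡ-sum (fromℕ n ⁻¹) (λ v → sum (row f v)) ⟨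
      fromℕ n ⁻¹ * ∑∑ f                       ≈⟨ *-congˡ (trans (sym (sum-remQuot f)) Σf≈0) ⟩
      fromℕ n ⁻¹ * 0#                         ≈⟨ zeroʳ _ ⟩
      0#                                      ∎

    sum-rowDeviation : ∀ v → sum (row (rowDeviation f) v) ≈ 0#
    sum-rowDeviation v = begin-equality
      sum (λ k → - μ + f (v , k))               ≈⟨ ∑-distrib-+ (λ _ → - μ) (row f v) ⟩
      sum {n} (λ _ → - μ) + sum (row f v)       ≈⟨ +-congʳ (sum-const n (- μ)) ⟩
      fromℕ n * - μ + sum (row f v)             ≈⟨ +-congʳ (-‿distribʳ-* (fromℕ n) μ) ⟨
      - (fromℕ n * μ) + sum (row f v)           ≈⟨ +-congʳ (-‿cong (fromℕ-inverseʳ n (sum (row f v)))) ⟩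
      - sum (row f v) + sum (row f v)           ≈⟨ -‿inverseˡ _ ⟩
      0#                                        ∎
      where μ = rowMean f v

    private
      p r : Fin m × Fin n → Carrier
      p = rowMean f ∘ proj₁
      r = rowDeviation f

    -- On each fibre `p` is constant while `r` sums to zero.
    ⟪mean,deviation⟫≈0 : ⟪ p , r ⟫ ≈ 0#
    ⟪mean,deviation⟫≈0 = begin-equality
      ⟪ p , r ⟫                                      ≈⟨ ⟪⟫≈∑∑ p r ⟩
      sum (λ v → sum (λ k → rowMean f v * row r v k)) ≈⟨ sum-cong-≋ (λ v → *-distribˡ-sum (rowMean f v) (row r v)) ⟨
      sum (λ v → rowMean f v * sum (row r v))        ≈⟨ sum-cong-≋ (λ v → *-congˡ (sum-rowDeviation v)) ⟩
      sum (λ v → rowMean f v * 0#)                   ≈⟨ sum-cong-≋ (λ v → zeroʳ (rowMean f v)) ⟩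
      sum {m} (λ _ → 0#)                             ≈⟨ trans (sum-const m 0#) (zeroʳ _) ⟩
      0#                                             ∎

    rowMean-pythagoras : ⟦ p ⟧ * ⟦ p ⟧ + ⟦ r ⟧ * ⟦ r ⟧ ≈ ⟦ f ⟧ * ⟦ f ⟧
    rowMean-pythagoras = begin-equality
      ⟦ p ⟧ * ⟦ p ⟧ + ⟦ r ⟧ * ⟦ r ⟧
        ≈⟨ +-cong (∥∥-square (p ∘ remQuot {m} n)) (∥∥-square (r ∘ remQuot {m} n)) ⟩
      ⟪ p , p ⟫ + ⟪ r , r ⟫
        ≈⟨ +-cong (+-identityʳ _) (+-identityˡ _) ⟨
      ⟪ p , p ⟫ + 0# + (0# + ⟪ r , r ⟫)
        ≈⟨ +-cong (+-congˡ ⟪mean,deviation⟫≈0)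
                  (+-congʳ (trans (⟨⟩-comm (r ∘ remQuot {m} n) (p ∘ remQuot {m} n)) ⟪mean,deviation⟫≈0)) ⟨
      ⟪ p , p ⟫ + ⟪ p , r ⟫ + (⟪ r , p ⟫ + ⟪ r , r ⟫)
        ≈⟨ ⟪⟫-expand p r p r ⟨
      ⟪ (λ x → p x + r x) , (λ x → p x + r x) ⟫
        ≈⟨ ⟪⟫-cong (rowMean+rowDeviation f) (rowMean+rowDeviation f) ⟨
      ⟪ f , f ⟫
        ≈⟨ ∥∥-square (f ∘ remQuot {m} n) ⟨
      ⟦ f ⟧ * ⟦ f ⟧ ∎

    ⟦mean⟧≤ : ⟦ p ⟧ ≤ ⟦ f ⟧
    ⟦mean⟧≤ = square-cancel-≤ (∥∥-nonNeg (f ∘ remQuot {m} n))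
      (≤-trans (x≤x+y (square-nonNeg ⟦ r ⟧)) (≤-reflexive rowMean-pythagoras))

    ⟦deviation⟧≤ : ⟦ r ⟧ ≤ ⟦ f ⟧
    ⟦deviation⟧≤ = square-cancel-≤ (∥∥-nonNeg (f ∘ remQuot {m} n))
      (≤-trans (x≤x+y (square-nonNeg ⟦ p ⟧)) (≤-reflexive (trans (+-comm _ _) rowMean-pythagoras)))

    module _ .{{_ : NonZero D}} (G : Graph n D) where

      -- B fixes the fibre-constant part, because averaging preserves constants.
      fibreWalk-split : ∀ x → fibreWalk G f x ≈ p x + fibreWalk G r x
      fibreWalk-split (v , k) = trans (walk-cong G (λ l → rowMean+rowDeviation f (v , l)) k)
        (walk-const+ G (rowMean f v) (row r v) k)

      -- Every row of `r` sums to zero, so the bound for `G` holds fibre by fibre, and squared norms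
      -- add over the fibres.
      fibreWalk-deviation : 0# ≤ x → SpectralBound G x → ⟦ fibreWalk G r ⟧ ≤ x * ⟦ r ⟧
      fibreWalk-deviation {x} 0≤x bound =
        ∥∥-≤ (*-nonNeg 0≤x (∥∥-nonNeg (r ∘ remQuot {m} n))) (fibreWalk G r ∘ remQuot {m} n) $ begin
        ⟪ fibreWalk G r , fibreWalk G r ⟫
          ≈⟨ ⟪⟫≈∑∑ (fibreWalk G r) (fibreWalk G r) ⟩
        sum (λ v → ⟨ walk G (row r v) , walk G (row r v) ⟩)
          ≤⟨ sum-mono-≤ (λ v → ∥∥-≤⁻¹ (walk G (row r v)) (bound (row r v) (sum-rowDeviation v))) ⟩
        sum (λ v → x * ∥ row r v ∥ * (x * ∥ row r v ∥))
          ≈⟨ sum-cong-≋ (λ v → trans (square-* x _) (*-congˡ (∥∥-square (row r v)))) ⟩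
        sum (λ v → x * x * ⟨ row r v , row r v ⟩)
          ≈⟨ *-distribˡ-sum (x * x) (λ v → ⟨ row r v , row r v ⟩) ⟨
        x * x * ∑∑ (λ y → r y * r y)
          ≈⟨ *-congˡ (⟪⟫≈∑∑ r r) ⟨
        x * x * ⟪ r , r ⟫
          ≈⟨ *-congˡ (∥∥-square (r ∘ remQuot {m} n)) ⟨
        x * x * (⟦ r ⟧ * ⟦ r ⟧)
          ≈⟨ square-* x ⟦ r ⟧ ⟨
        x * ⟦ r ⟧ * (x * ⟦ r ⟧) ∎
        where
        square-* : ∀ x y → x * y * (x * y) ≈ x * x * (y * y)
        square-* = solve 2 (λ x y → x :* y :* (x :* y) := x :* x :* (y :* y)) refl

  fibreWalk-selfAdjoint : (G : Graph n D) (f g : Fin m × Fin n → Carrier) →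
    ⟪ fibreWalk G f , g ⟫ ≈ ⟪ f , fibreWalk G g ⟫
  fibreWalk-selfAdjoint G f g = begin-equality
    ⟪ fibreWalk G f , g ⟫                          ≈⟨ ⟪⟫≈∑∑ (fibreWalk G f) g ⟩
    sum (λ v → ⟨ walk G (row f v) , row g v ⟩)     ≈⟨ sum-cong-≋ (λ v → walk-selfAdjoint G (row f v) (row g v)) ⟩
    sum (λ v → ⟨ row f v , walk G (row g v) ⟩)     ≈⟨ ⟪⟫≈∑∑ f (fibreWalk G g) ⟨
    ⟪ f , fibreWalk G g ⟫                          ∎

  -- Between fibre-constant functions P acts as the walk on `G`: the form is
  -- `fromℕ D * ⟨ walk G α , β ⟩`, and Cauchy-Schwarz applies.
  ⟪∘rot,∘proj₁⟫≤ : .{{_ : NonZero D}} (G : Graph N D) → 0# ≤ x → SpectralBound G x →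
    (α β : Vector Carrier N) → sum α ≈ 0# →
    ⟪ α ∘ proj₁ ∘ rot G , β ∘ proj₁ ⟫ ≤ x * ⟦_⟧ {N} {D} (α ∘ proj₁) * ⟦_⟧ {N} {D} (β ∘ proj₁)
  ⟪∘rot,∘proj₁⟫≤ {D} {N} {x} G 0≤x bound α β Σα≈0 = begin
    ⟪ α ∘ proj₁ ∘ rot G , β ∘ proj₁ ⟫
      ≈⟨ ⟪⟫≈∑∑ (α ∘ proj₁ ∘ rot G) (β ∘ proj₁) ⟩
    ∑∑ (λ y → α (proj₁ (rot G y)) * β (proj₁ y))
      ≈⟨ fromℕ-inverseʳ D _ ⟨
    d * (d ⁻¹ * ∑∑ (λ y → α (proj₁ (rot G y)) * β (proj₁ y)))
      ≈⟨ *-congˡ (⟨walk,⟩ G α β) ⟨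
    d * ⟨ walk G α , β ⟩
      ≈⟨ ⟪∘proj₁⟫ {N} {D} (walk G α) β ⟨
    ⟪_,_⟫ {N} {D} (walk G α ∘ proj₁) (β ∘ proj₁)
      ≤⟨ ⟪⟫≤ {N} {D} (walk G α ∘ proj₁) (β ∘ proj₁) walk≤ ≤-refl ⟩
    x * ⟦α⟧ * ⟦_⟧ {N} {D} (β ∘ proj₁) ∎
    where
    d = fromℕ D
    lift′ : Vector Carrier N → Vector Carrier (N ℕ.* D)
    lift′ γ = γ ∘ proj₁ ∘ remQuot {N} D
    ⟦α⟧ = ∥ lift′ α ∥
    walk≤ : ∥ lift′ (walk G α) ∥ ≤ x * ⟦α⟧
    -- Lifting multiplies both squared norms by `d`, so the bound for `walk G α` survives it.
    walk≤ = ∥∥-≤ (*-nonNeg 0≤x (∥∥-nonNeg (lift′ α))) (lift′ (walk G α)) $ begin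
      ⟨ lift′ (walk G α) , lift′ (walk G α) ⟩
        ≈⟨ ⟪∘proj₁⟫ {N} {D} (walk G α) (walk G α) ⟩
      d * ⟨ walk G α , walk G α ⟩
        ≤⟨ *-monoʳ-≤ (fromℕ-nonNeg D) (∥∥-≤⁻¹ (walk G α) (bound α Σα≈0)) ⟩
      d * (x * ∥ α ∥ * (x * ∥ α ∥))
        ≈⟨ solve 3 (λ d x a → d :* (x :* a :* (x :* a)) := x :* x :* (d :* (a :* a))) refl d x ∥ α ∥ ⟩
      x * x * (d * (∥ α ∥ * ∥ α ∥))
        ≈⟨ *-congˡ (*-congˡ (∥∥-square α)) ⟩
      x * x * (d * ⟨ α , α ⟩)
        ≈⟨ *-congˡ (⟪∘proj₁⟫ {N} {D} α α) ⟨
      x * x * ⟨ lift′ α , lift′ α ⟩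
        ≈⟨ *-congˡ (∥∥-square (lift′ α)) ⟨
      x * x * (⟦α⟧ * ⟦α⟧)
        ≈⟨ solve 2 (λ x a → x :* x :* (a :* a) := x :* a :* (x :* a)) refl x ⟦α⟧ ⟩
      x * ⟦α⟧ * (x * ⟦α⟧) ∎

  -- The walk on the product as BPB

  module _ {N₁ D₁ D₂} (G₁ : Graph N₁ D₁) (G₂ : Graph D₁ D₂) where

    zigzagStep : (Fin N₁ × Fin D₁ → Carrier) → Fin N₁ × Fin D₁ → Carrier
    zigzagStep f = fibreWalk G₂ (fibreWalk G₂ f ∘ rot G₁)

    -- The end vertex of a zig-zag step depends on `i` through the first move in `G₂` and on `j`
    -- through the second, so averaging over `(i , j)` is two nested averages with `rot G₁` between
    -- them.
    walk-ⓩ : .{{_ : NonZero D₂}} (f : Fin N₁ × Fin D₁ → Carrier) →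
      ∀ i → walk (G₁ ⓩ G₂) (f ∘ remQuot {N₁} D₁) i ≈ zigzagStep f (remQuot {N₁} D₁ i)
    walk-ⓩ f i = begin-equality
      fromℕ (D₂ ℕ.* D₂) ⁻¹ * sum (λ e → f (remQuot {N₁} D₁ (proj₁ (rot (G₁ ⓩ G₂) (i , e)))))
        ≈⟨ *-congˡ (sum-cong-≋ {D₂ ℕ.* D₂} (λ e →
             reflexive (≡.cong f (Fin.remQuot-combine (proj₁ (dest e)) (proj₂ (dest e)))))) ⟩
      fromℕ (D₂ ℕ.* D₂) ⁻¹ * sum (target ∘ remQuot {D₂} D₂)
        ≈⟨ *-congˡ (sum-remQuot target) ⟩
      fromℕ (D₂ ℕ.* D₂) ⁻¹ * ∑∑ target
        ≈⟨ fromℕ⁻¹-* D₂ D₂ (∑∑ target) ⟩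
      fromℕ D₂ ⁻¹ * (fromℕ D₂ ⁻¹ * ∑∑ target)
        -- With the second factor moved under the outer sum, the expression is `zigzagStep`
        -- unfolded.
        ≈⟨ *-congˡ (*-distribˡ-sum (fromℕ D₂ ⁻¹) (λ j → sum (row target j))) ⟩
      zigzagStep f (remQuot {N₁} D₁ i) ∎
      where
      dest : Fin (D₂ ℕ.* D₂) → Fin N₁ × Fin D₁
      dest e = proj₁ (zigzagRot G₁ G₂ (remQuot {N₁} D₁ i , remQuot {D₂} D₂ e))
      target : Fin D₂ × Fin D₂ → Carrier
      target e = f (proj₁ (zigzagRot G₁ G₂ (remQuot {N₁} D₁ i , e)))

  -- The spectral bound for the product

  module _ {N₁ D₁ D₂} .{{_ : NonZero D₁}} .{{_ : NonZero D₂}}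
           {λ₁ λ₂ : Carrier} (0≤λ₁ : 0# ≤ λ₁) (0≤λ₂ : 0# ≤ λ₂) (G₁ : Graph N₁ D₁) (G₂ : Graph D₁ D₂)
           (bound₁ : SpectralBound G₁ λ₁) (bound₂ : SpectralBound G₂ λ₂) where

    private
      flatten : (Fin N₁ × Fin D₁ → Carrier) → Vector Carrier (N₁ ℕ.* D₁)
      flatten f = f ∘ remQuot {N₁} D₁

      Λ : Carrier
      Λ = λ₁ + λ₂ + λ₂ * λ₂

    0≤Λ : 0# ≤ Λ
    0≤Λ = +-nonNeg (+-nonNeg 0≤λ₁ 0≤λ₂) (*-nonNeg 0≤λ₂ 0≤λ₂)

    ⟪zigzagStep,⟫≤ : (f h : Fin N₁ × Fin D₁ → Carrier) → sum (flatten f) ≈ 0# →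
      ⟪ zigzagStep G₁ G₂ f , h ⟫ ≤ Λ * (⟦ f ⟧ * ⟦ h ⟧)
    ⟪zigzagStep,⟫≤ f h Σf≈0 = begin
      ⟪ zigzagStep G₁ G₂ f , h ⟫
        ≈⟨ fibreWalk-selfAdjoint G₂ (fibreWalk G₂ f ∘ rot G₁) h ⟩
      ⟪ fibreWalk G₂ f ∘ rot G₁ , fibreWalk G₂ h ⟫
        ≈⟨ ⟪⟫-cong (λ y → fibreWalk-split f G₂ (rot G₁ y)) (fibreWalk-split h G₂) ⟩
      ⟪ (λ y → p (rot G₁ y) + s (rot G₁ y)) , (λ y → p′ y + s′ y) ⟫
        ≈⟨ ⟪⟫-expand (p ∘ rot G₁) (s ∘ rot G₁) p′ s′ ⟩
      ⟪ p ∘ rot G₁ , p′ ⟫ + ⟪ p ∘ rot G₁ , s′ ⟫ + (⟪ s ∘ rot G₁ , p′ ⟫ + ⟪ s ∘ rot G₁ , s′ ⟫)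
        ≤⟨ +-mono-≤
             -- The mean-mean term uses `G₁`; the other three use Cauchy-Schwarz, gaining a factor
             -- `λ₂` for each deviation.
             (+-mono-≤ (⟪∘rot,∘proj₁⟫≤ G₁ 0≤λ₁ bound₁ (rowMean f) (rowMean h) (sum-rowMean f Σf≈0))
                       (⟪⟫≤ (p ∘ rot G₁) s′ (⟦∘rot⟧≤ G₁ p) s′≤))
             (+-mono-≤ (⟪⟫≤ (s ∘ rot G₁) p′ (≤-trans (⟦∘rot⟧≤ G₁ s) s≤) ≤-refl)
                       (⟪⟫≤ (s ∘ rot G₁) s′ (≤-trans (⟦∘rot⟧≤ G₁ s) s≤) s′≤)) ⟩
      λ₁ * a * a′ + a * (λ₂ * b′) + (λ₂ * b * a′ + λ₂ * b * (λ₂ * b′))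
        ≈⟨ solve 6 (λ x y a b a′ b′ → x :* a :* a′ :+ a :* (y :* b′) :+ (y :* b :* a′ :+ y :* b :* (y :* b′))
                     := x :* (a :* a′) :+ y :* (a :* b′ :+ b :* a′) :+ y :* y :* (b :* b′)) refl λ₁ λ₂ a b a′ b′ ⟩
      λ₁ * (a * a′) + λ₂ * (a * b′ + b * a′) + λ₂ * λ₂ * (b * b′)
        ≤⟨ +-mono-≤ (+-mono-≤
             (*-monoʳ-≤ 0≤λ₁ (*-mono-≤ (norm≥0 p) (norm≥0 h) (⟦mean⟧≤ f) (⟦mean⟧≤ h)))
             -- The planar vectors are `(a , b)` and `(b′ , a′)`; the swap in the second accounts
             -- for `+-comm`.
             (*-monoʳ-≤ 0≤λ₂ (cauchySchwarz₂ (norm≥0 f) (norm≥0 h) (≤-reflexive (rowMean-pythagoras f))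
               (≤-reflexive (trans (+-comm _ _) (rowMean-pythagoras h))))))
             (*-monoʳ-≤ (square-nonNeg λ₂)
               (*-mono-≤ (norm≥0 (rowDeviation f)) (norm≥0 h) (⟦deviation⟧≤ f) (⟦deviation⟧≤ h))) ⟩
      λ₁ * F + λ₂ * F + λ₂ * λ₂ * F
        ≈⟨ solve 3 (λ x y z → x :* z :+ y :* z :+ y :* y :* z := (x :+ y :+ y :* y) :* z) refl λ₁ λ₂ F ⟩
      Λ * F ∎
      where
      F = ⟦ f ⟧ * ⟦ h ⟧
      p p′ s s′ : Fin N₁ × Fin D₁ → Carrier
      p  = rowMean f ∘ proj₁
      p′ = rowMean h ∘ proj₁
      s  = fibreWalk G₂ (rowDeviation f)
      s′ = fibreWalk G₂ (rowDeviation h)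
      a  = ⟦ p ⟧
      a′ = ⟦ p′ ⟧
      b  = ⟦ rowDeviation f ⟧
      b′ = ⟦ rowDeviation h ⟧
      norm≥0 : (g : Fin N₁ × Fin D₁ → Carrier) → 0# ≤ ⟦ g ⟧
      norm≥0 g = ∥∥-nonNeg (flatten g)
      s≤ : ⟦ s ⟧ ≤ λ₂ * b
      s≤ = fibreWalk-deviation f G₂ 0≤λ₂ bound₂
      s′≤ : ⟦ s′ ⟧ ≤ λ₂ * b′
      s′≤ = fibreWalk-deviation h G₂ 0≤λ₂ bound₂

    ⟦zigzagStep⟧≤ : (f : Fin N₁ × Fin D₁ → Carrier) → sum (flatten f) ≈ 0# → ⟦ zigzagStep G₁ G₂ f ⟧ ≤ Λ * ⟦ f ⟧
    -- Testing against `h`, the image of `f` itself, leaves a common factor `⟦ h ⟧` to cancel,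
    -- possibly zero.
    ⟦zigzagStep⟧≤ f Σf≈0 = x*x≤y*x⇒x≤y (*-nonNeg 0≤Λ (∥∥-nonNeg (flatten f))) $ begin
      ⟦ h ⟧ * ⟦ h ⟧          ≈⟨ ∥∥-square (flatten h) ⟩
      ⟪ h , h ⟫              ≤⟨ ⟪zigzagStep,⟫≤ f h Σf≈0 ⟩
      Λ * (⟦ f ⟧ * ⟦ h ⟧)    ≈⟨ *-assoc _ _ _ ⟨
      Λ * ⟦ f ⟧ * ⟦ h ⟧      ∎
      where h = zigzagStep G₁ G₂ f

    SpectralBound-ⓩ : SpectralBound (G₁ ⓩ G₂) Λ
    SpectralBound-ⓩ α Σα≈0 = begin
      ∥ walk (G₁ ⓩ G₂) α ∥            ≈⟨ ∥∥-cong (walk-cong (G₁ ⓩ G₂) α≈flatten) ⟩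
      ∥ walk (G₁ ⓩ G₂) (flatten f) ∥  ≈⟨ ∥∥-cong (walk-ⓩ G₁ G₂ f) ⟩
      ⟦ zigzagStep G₁ G₂ f ⟧                ≤⟨ ⟦zigzagStep⟧≤ f (trans (sym (sum-cong-≋ α≈flatten)) Σα≈0) ⟩
      Λ * ⟦ f ⟧                       ≈⟨ *-congˡ (∥∥-cong α≈flatten) ⟨
      Λ * ∥ α ∥                       ∎
      where
      f : Fin N₁ × Fin D₁ → Carrier
      -- Reads `α` as a function on pairs; flattening it again recovers `α` pointwise.
      f = α ∘ uncurry combine
      α≈flatten : ∀ i → α i ≈ flatten f i
      α≈flatten i = reflexive (≡.cong α (≡.sym (Fin.combine-remQuot {N₁} D₁ i)))

theorem1p3 : ∀ {c ℓ₁ ℓ₂} (ℝ : CompleteOrderedField c ℓ₁ ℓ₂) →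
    let open CompleteOrderedField ℝ
        open Spectral ℝ
    in (N₁ D₁ D₂ : ℕ) .{{_ : NonZero N₁}} .{{_ : NonZero D₁}} .{{_ : NonZero D₂}}
       (λ₁ λ₂ : Carrier) (G₁ : Graph N₁ D₁) (G₂ : Graph D₁ D₂) →
       IsNDλGraph N₁ D₁ λ₁ G₁ →
       IsNDλGraph D₁ D₂ λ₂ G₂ →
       IsNDλGraph (N₁ ℕ.* D₁) (D₂ ℕ.* D₂) (λ₁ + λ₂ + λ₂ * λ₂) (G₁ ⓩ G₂)
theorem1p3 ℝ N₁ D₁ D₂ λ₁ λ₂ G₁ G₂ λG₁≤λ₁ λG₂≤λ₂ =
  SpectralBound⇒IsNDλGraph ℝ {{ℕ.m*n≢0 N₁ D₁}} (G₁ ⓩ G₂) (0≤Λ ℝ 0≤λ₁ 0≤λ₂ G₁ G₂ bound₁ bound₂)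
    (SpectralBound-ⓩ ℝ 0≤λ₁ 0≤λ₂ G₁ G₂ bound₁ bound₂)
  where
  open CompleteOrderedField ℝ using (0#; _≤_; isDecTotalOrder)
  open IsDecTotalOrder isDecTotalOrder using () renaming (trans to ≤-trans)
  -- The signs of `λ₁` and `λ₂` follow from the nonnegative eigenvalues that they bound.
  0≤λ₁ : 0# ≤ λ₁
  0≤λ₁ = ≤-trans (secondEigenvalue-nonNeg ℝ G₁) λG₁≤λ₁
  0≤λ₂ : 0# ≤ λ₂
  0≤λ₂ = ≤-trans (secondEigenvalue-nonNeg ℝ G₂) λG₂≤λ₂
  bound₁ : SpectralBound ℝ G₁ λ₁
  bound₁ = IsNDλGraph⇒SpectralBound ℝ G₁ λG₁≤λ₁
  bound₂ : SpectralBound ℝ G₂ λ₂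
  bound₂ = IsNDλGraph⇒SpectralBound ℝ G₂ λG₂≤λ₂
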